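{- Let $G=(V,E)$ be a graph with $n$ vertices, $m$ edges, average degree $\bar d$, and no isolated vertices, and let $\rho$ be the ratio between the maximum degree and the minimum degree of $G$. Then $$\frac{1}{m!}\cdot\frac{1}{n}\sum_{\pi\in\Pi}\sum_{v\in V}N(\pi,v)=O(\rho\cdot\bar d).$$
   Context: $G$ may contain parallel edges and self-loops (a self-loop contributes $2$ to the degree of its vertex). $\Pi$ is the set of all rankings (bijections) $\pi:E\to[m]$. For a ranking $\pi$ define two recursive oracles. The matching oracle $\mathrm{MO}^\pi(e)$: if the answer for $e$ was already computed, return it; otherwise let $e_1,\dots,e_t$ be the edges sharing an endpoint with $e$, ordered by increasing rank; for $i=1,2,\dots$ while $\pi(e_i)<\pi(e)$: if $\mathrm{MO}^\pi(e_i)=$ TRUE return FALSE; if the loop ends, return TRUE. (This computes whether $e$ belongs to the greedy maximal matching obtained by processing edges in increasing rank order.) The vertex cover oracle $\mathrm{VO}^\pi(v)$: let $e_1,\dots,e_t$ be the edges incident to $v$ in increasing rank; for $i=1,\dots,t$: if $\mathrm{MO}^\pi(e_i)=$ TRUE return TRUE; finally return FALSE. $N(\pi,v)$ is the number of distinct edges $e$ such that a call $\mathrm{MO}^\pi(e)$ is made in the course of computing $\mathrm{VO}^\pi(v)$. -}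

module Defs where

open import Data.Nat using (ℕ; zero; suc; _+_; _*_; _⊔_; _⊓_; _<ᵇ_; _≡ᵇ_; _!)
open import Data.Bool using (Bool; true; false; if_then_else_; _∨_; _∧_; not)
open import Data.Fin using (Fin; toℕ)
open import Data.Fin.Properties using (_≟_)
open import Data.Product using (_×_; _,_; proj₁; proj₂)
open import Data.List using (List; []; _∷_; _++_; map; concatMap; filterᵇ; takeWhileᵇ; deduplicate; length; upTo; allFin)
open import Data.Nat.ListAction using (sum)
open import Data.Bool.ListAction using (all)
open import Data.Vec using (Vec; lookup) renaming ([] to []ᵥ; _∷_ to _∷ᵥ_)
open import Relation.Nullary.Decidable using (⌊_⌋)

-- A multigraph on vertex set Fin n with edge set Fin m; edge e has endpoints
-- ends e = (u , w); a self-loop has u ≡ w.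
module _ {n m : ℕ} (ends : Fin m → Fin n × Fin n) where

  _==_ : ∀ {k} → Fin k → Fin k → Bool
  a == b = ⌊ a ≟ b ⌋

  incident : Fin n → Fin m → Bool
  incident v e = (proj₁ (ends e) == v) ∨ (proj₂ (ends e) == v)

  -- degree; a self-loop contributes 2
  degree : Fin n → ℕ
  degree v = sum (map (λ e → (if proj₁ (ends e) == v then 1 else 0)
                           + (if proj₂ (ends e) == v then 1 else 0)) (allFin m))

  maxDegree : ℕ
  maxDegree = Data.List.foldr _⊔_ 0 (map degree (allFin n))

  -- minimum degree (seeded with maxDegree; correct whenever n ≥ 1)
  minDegree : ℕ
  minDegree = Data.List.foldr _⊓_ maxDegree (map degree (allFin n))

  adjacent : Fin m → Fin m → Bool
  adjacent e e' = incident (proj₁ (ends e)) e' ∨ incident (proj₂ (ends e)) e'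

  -- A ranking π : E → [m] is represented as a vector (π e = lookup π e);
  -- ranks are 0-based.
  module _ (π : Vec (Fin m) m) where

    rank : Fin m → ℕ
    rank e = toℕ (lookup π e)

    byRank : List (Fin m)
    byRank = concatMap (λ r → filterᵇ (λ e → rank e ≡ᵇ r) (allFin m)) (upTo m)

    -- Matching oracle without memoization (memoization does not change the
    -- set of edges on which MO is called). Returns (answer , list of edges on
    -- which MO was called, with repetitions). The first argument is fuel; each
    -- recursive call strictly decreases the rank, so fuel m never runs out and
    -- the 'zero' clause is unreachable.
    MO : ℕ → Fin m → Bool × List (Fin m)
    MO zero e = true , e ∷ []
    MO (suc k) e =
      loop (takeWhileᵇ (λ e' → rank e' <ᵇ rank e) (filterᵇ (adjacent e) byRank))
      where
      loop : List (Fin m) → Bool × List (Fin m)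
      loop [] = true , e ∷ []
      loop (e' ∷ es) with MO k e'
      ... | true  , cs = false , e ∷ cs
      ... | false , cs with loop es
      ...   | b , cs' = b , cs ++ cs'

    VO : Fin n → Bool × List (Fin m)
    VO v = go (filterᵇ (incident v) byRank)
      where
      go : List (Fin m) → Bool × List (Fin m)
      go [] = false , []
      go (e ∷ es) with MO m e
      ... | true  , cs = true , cs
      ... | false , cs with go es
      ...   | b , cs' = b , cs ++ cs'

    N : Fin n → ℕ
    N v = length (deduplicate _≟_ (proj₂ (VO v)))

  allVecs : (k : ℕ) → List (Vec (Fin m) k)
  allVecs zero = []ᵥ ∷ []
  allVecs (suc k) = concatMap (λ i → map (i ∷ᵥ_) (allVecs k)) (allFin m)

  isRanking : Vec (Fin m) m → Bool
  isRanking π = all (λ i → all (λ j → not (lookup π i == lookup π j) ∨ (i == j)) (allFin m)) (allFin m)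

  rankings : List (Vec (Fin m) m)
  rankings = filterᵇ isRanking (allVecs m)

  totalN : ℕ
  totalN = sum (map (λ π → sum (map (N π) (allFin n))) rankings)

-- Process the edges in rank order and keep, for every vertex v, the flag "v is
-- still unmatched" and an upper bound cost v on the number of edges that VO(v)
-- has visited so far.  When the edge (a , b) arrives and a is unmatched, VO(a)
-- calls MO on it; that call explores, apart from the edges already seen from a,
-- only the edge itself and what VO(b) explores.  So cost a grows by at most
-- 1 + cost b; if both ends are unmatched they become matched and freeze.
--
-- Give an edge (a , b) the potential [a free](1 + cost b) + [b free](1 + cost a),
-- the increase of the total cost if it were to arrive now.  For two edges x and y,
-- potential of y after x plus potential of x after y is at most the sum of their
-- present potentials: what x adds to y's potential when x comes first is
-- compensated by what it loses when y comes first and matches the shared vertex.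
-- Hence the average potential of a remaining edge does not increase in
-- expectation under a uniformly random order.  It starts at 2 or less, so the
-- expected total cost after m edges is at most 2m, which gives the bound with
-- C = 1 because the minimum degree is at most the maximum degree.

module Submission where

open import Defs
open import Data.Bool using (Bool; true; false; if_then_else_; _∨_; _∧_; not; T)
open import Data.Bool.Properties using (∨-comm; ∧-comm; not-involutive)
open import Data.Fin using (Fin; zero; suc; toℕ)
open import Data.Fin.Properties using (_≟_; toℕ<n; toℕ-injective; any?; punchOut-injective; injective⇒≤)
open import Data.List using (List; []; _∷_; _++_; _∷ʳ_; [_]; map; concat; concatMap; applyUpTo; upTo; tabulate; filterᵇ; takeWhileᵇ; cartesianProductWith; foldr; foldl; length; allFin)
open import Data.List.Membership.Propositional using (_∈_)
open import Data.List.Membership.Propositional.Properties using (∈-map⁺; ∈-map⁻; ∈-concatMap⁺; ∈-++⁺ˡ; ∈-++⁺ʳ; ∈-++⁻; ∈-allFin; ∈-filter⁻; ∈-deduplicate⁻)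
import Data.List.Properties as List
open import Data.List.Relation.Binary.Subset.Propositional using (_⊆_)
open import Data.List.Relation.Binary.Subset.Propositional.Properties using (⊆-trans; ++⁺; ++⁺ʳ; ∷⁺ʳ; ∈-∷⁺ʳ; xs⊆xs++ys; xs⊆ys++xs)
open import Data.List.Relation.Unary.All as All using (All; []; _∷_)
open import Data.List.Relation.Unary.All.Properties using (all-takeWhile; all⁺)
open import Data.List.Relation.Unary.AllPairs using (AllPairs; []; _∷_)
import Data.List.Relation.Unary.AllPairs.Properties as AllPairs
open import Data.List.Relation.Unary.Any as Any using (here; there)
open import Data.List.Relation.Unary.Unique.DecPropositional.Properties using (deduplicate-!)
open import Data.List.Relation.Unary.Unique.Propositional using (Unique)
import Data.List.Relation.Unary.Unique.Propositional.Properties as Unique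
open import Data.Nat using (ℕ; zero; suc; _+_; _*_; _≤_; _<_; z≤n; s≤s; s≤s⁻¹; _⊓_; _<ᵇ_; _≡ᵇ_; _!)
open import Data.Nat.ListAction using (sum)
open import Data.Nat.ListAction.Properties using (sum-++)
open import Data.Nat.Properties hiding (_≟_)
open import Data.Nat.Tactic.RingSolver using (solve-∀)
open import Data.Product using (Σ; _×_; _,_; proj₁; proj₂; ∃; swap)
open import Data.Sum using ([_,_]′)
open import Data.Vec as Vec using (Vec; lookup) renaming (_∷_ to _∷ᵥ_)
import Data.Vec.Properties as Vec
open import Function using (_∘_; id; Injective)
open import Relation.Binary.PropositionalEquality using (_≡_; _≢_; refl; sym; trans; cong; cong₂; subst; subst₂; ≢-sym; module ≡-Reasoning)
open import Relation.Nullary using (Dec; yes; no; contradiction)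
open import Relation.Nullary.Decidable using (⌊_⌋; isYes≗does; dec-true; dec-false; T?)

private variable
  n m : ℕ
  X Y : Set

-- Sums over lists and over the orders of a list

∑ : List X → (X → ℕ) → ℕ
∑ xs f = sum (map f xs)

∑-++ : (xs ys : List X) {f : X → ℕ} → ∑ (xs ++ ys) f ≡ ∑ xs f + ∑ ys f
∑-++ xs ys {f} = trans (cong sum (List.map-++ f xs ys)) (sum-++ (map f xs) (map f ys))

∑-map : (g : X → Y) (xs : List X) {f : Y → ℕ} → ∑ (map g xs) f ≡ ∑ xs (f ∘ g)
∑-map g xs = cong sum (sym (List.map-∘ xs))

∑-concatMap : (g : X → List Y) (xs : List X) {f : Y → ℕ} →
              ∑ (concatMap g xs) f ≡ ∑ xs (λ x → ∑ (g x) f)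
∑-concatMap g []       = refl
∑-concatMap g (x ∷ xs) = trans (∑-++ (g x) _) (cong (_ +_) (∑-concatMap g xs))

∑-mono-∈ : {xs : List X} {f g : X → ℕ} → (∀ {x} → x ∈ xs → f x ≤ g x) → ∑ xs f ≤ ∑ xs g
∑-mono-∈ {xs = []}     f≤g = z≤n
∑-mono-∈ {xs = x ∷ xs} f≤g = +-mono-≤ (f≤g (here refl)) (∑-mono-∈ (f≤g ∘ there))

∑-mono : (xs : List X) {f g : X → ℕ} → (∀ x → f x ≤ g x) → ∑ xs f ≤ ∑ xs g
∑-mono xs f≤g = ∑-mono-∈ {xs = xs} (λ {x} _ → f≤g x)

∑-+ : (xs : List X) {f g : X → ℕ} → ∑ xs (λ x → f x + g x) ≡ ∑ xs f + ∑ xs g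
∑-+ []               = refl
∑-+ (x ∷ xs) {f} {g} = trans (cong (f x + g x +_) (∑-+ xs))
  (+-exchange (f x) (g x) _ _)
  where
  +-exchange : ∀ a b c d → a + b + (c + d) ≡ a + c + (b + d)
  +-exchange = solve-∀

∑-const : (xs : List X) (c : ℕ) → ∑ xs (λ _ → c) ≡ length xs * c
∑-const []       c = refl
∑-const (x ∷ xs) c = cong (c +_) (∑-const xs c)

∑-*ˡ : (c : ℕ) (xs : List X) {f : X → ℕ} → ∑ xs (λ x → c * f x) ≡ c * ∑ xs f
∑-*ˡ c []           = sym (*-zeroʳ c)
∑-*ˡ c (x ∷ xs) {f} = trans (cong (c * f x +_) (∑-*ˡ c xs)) (sym (*-distribˡ-+ c (f x) _))

-- Drawing entries without replacement.

picks : List X → List (X × List X)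
picks []       = []
picks (x ∷ xs) = (x , xs) ∷ map (λ (y , ys) → y , x ∷ ys) (picks xs)

∑-picks : (xs : List X) {f : X → ℕ} → ∑ (picks xs) (f ∘ proj₁) ≡ ∑ xs f
∑-picks []           = refl
∑-picks (x ∷ xs) {f} = cong (f x +_) (trans (∑-map _ (picks xs)) (∑-picks xs))

∈-picks⇒length : {xs : List X} {p : X × List X} → p ∈ picks xs →
                 length xs ≡ suc (length (proj₂ p))
∈-picks⇒length {xs = x ∷ xs} (here refl) = refl
∈-picks⇒length {xs = x ∷ xs} (there p∈) with ∈-map⁻ _ p∈
... | _ , q∈ , refl = cong suc (∈-picks⇒length q∈)

-- Serves as deletion of `x` over a type whose equality need not be decidable: one occurrence is
-- taken out, and every other value is certain to survive.
∈⇒∈-picks : {x : X} {xs : List X} → x ∈ xs →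
            ∃ λ ys → (x , ys) ∈ picks xs × (∀ {y} → y ∈ xs → y ≢ x → y ∈ ys)
∈⇒∈-picks {xs = z ∷ zs} (here refl) = zs , here refl , λ where
  (here refl) y≢x → contradiction refl y≢x
  (there y∈)  _   → y∈
∈⇒∈-picks {xs = z ∷ zs} (there x∈) with ∈⇒∈-picks x∈
... | ys , p∈ , rest = z ∷ ys , there (∈-map⁺ _ p∈) , λ where
  (here refl) _   → here refl
  (there y∈)  y≢x → there (rest y∈ y≢x)

∑-picks-∈ : {xs : List X} {p : X × List X} {f : X → ℕ} → p ∈ picks xs →
            ∑ xs f ≡ f (proj₁ p) + ∑ (proj₂ p) f
∑-picks-∈ {xs = x ∷ xs} (here refl) = refl
∑-picks-∈ {xs = x ∷ xs} {f = f} (there p∈) with ∈-map⁻ _ p∈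
... | (y , ys) , q∈ , refl = trans (cong (f x +_) (∑-picks-∈ q∈)) (+-swap (f x) (f y) _)
  where
  +-swap : ∀ a b c → a + (b + c) ≡ b + (a + c)
  +-swap = solve-∀

-- Induction on `xs`: the head `x` is picked out of `ys`; the tail avoids `x` because its entries
-- are distinct, so it still lies in the remainder.
Unique-⊆-∑ : {xs ys : List X} {f : X → ℕ} → Unique xs → xs ⊆ ys → ∑ xs f ≤ ∑ ys f
Unique-⊆-∑ []                       _     = z≤n
Unique-⊆-∑ {xs = x ∷ xs} {f = f} u@(_ ∷ uxs) xs⊆ys with ∈⇒∈-picks (xs⊆ys (here refl))
... | zs , p∈ , rest = ≤-trans
  (+-monoʳ-≤ (f x) (Unique-⊆-∑ uxs λ y∈ → rest (xs⊆ys (there y∈)) λ { refl → Unique.Unique[x∷xs]⇒x∉xs u y∈ }))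
  (≤-reflexive (sym (∑-picks-∈ p∈)))

Unique-⊆-length : {xs ys : List X} → Unique xs → xs ⊆ ys → length xs ≤ length ys
Unique-⊆-length {xs = xs} {ys} uxs xs⊆ys = subst₂ _≤_ (∑-1 xs) (∑-1 ys) (Unique-⊆-∑ uxs xs⊆ys)
  where
  ∑-1 : (zs : List X) → ∑ zs (λ _ → 1) ≡ length zs
  ∑-1 zs = trans (∑-const zs 1) (*-identityʳ _)

-- Plays the role of a uniformly random order: for `k = length xs` it lists all permutations of the
-- positions, and sums over it replace expectations.
orders : ℕ → List X → List (List X)
orders zero    xs = [] ∷ []
orders (suc k) xs = concatMap (λ (x , ys) → map (x ∷_) (orders k ys)) (picks xs)

∑-orders-suc : (k : ℕ) (xs : List X) {f : List X → ℕ} →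
               ∑ (orders (suc k) xs) f ≡ ∑ (picks xs) (λ (x , ys) → ∑ (orders k ys) (f ∘ (x ∷_)))
∑-orders-suc k xs = trans (∑-concatMap _ (picks xs))
  (cong sum (List.map-cong (λ (x , ys) → ∑-map (x ∷_) (orders k ys)) (picks xs)))

Unique-⊆-orders : {xs ys : List X} → Unique xs → xs ⊆ ys → xs ∈ orders (length xs) ys
Unique-⊆-orders []                _     = here refl
Unique-⊆-orders {xs = x ∷ xs} u@(_ ∷ uxs) xs⊆ys with ∈⇒∈-picks (xs⊆ys (here refl))
... | zs , p∈ , rest = ∈-concatMap⁺ _ (Any.map (λ { refl → ∈-map⁺ (x ∷_)
  (Unique-⊆-orders uxs λ y∈ → rest (xs⊆ys (there y∈)) λ { refl → Unique.Unique[x∷xs]⇒x∉xs u y∈ }) }) p∈)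

-- Double counting: each pair of positions contributes `h` in both orders, hence at most
-- `j x + j y`, and each entry lies in one pair fewer than the length. The summand `∑ xs j` on the
-- left avoids writing that factor as a subtraction.
∑-picks-pairs : {h : X → X → ℕ} {j : X → ℕ} → (∀ x y → h x y + h y x ≤ j x + j y) →
                (xs : List X) →
                ∑ (picks xs) (λ (x , ys) → ∑ ys (h x)) + ∑ xs j ≤ length xs * ∑ xs j
∑-picks-pairs pair [] = z≤n
∑-picks-pairs {h = h} {j} pair (x ∷ xs) = begin
  H + ∑ (map _ (picks xs)) _ + (j x + J)
    ≡⟨ cong (λ t → H + t + (j x + J)) (trans (∑-map _ (picks xs)) (∑-+ (picks xs))) ⟩
  H + (∑ (picks xs) ((λ y → h y x) ∘ proj₁) + P) + (j x + J)
    ≡⟨ cong (λ t → H + (t + P) + (j x + J)) (∑-picks xs) ⟩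
  H + (H′ + P) + (j x + J)
    ≡⟨ regroup H H′ P (j x) J ⟩
  H + H′ + (P + J) + j x
    ≤⟨ +-monoˡ-≤ (j x) (+-mono-≤ crossing (∑-picks-pairs pair xs)) ⟩
  length xs * j x + J + length xs * J + j x
    ≡⟨ collect (length xs) (j x) J ⟩
  suc (length xs) * (j x + J) ∎
  where
  open ≤-Reasoning
  H  = ∑ xs (h x)
  H′ = ∑ xs (λ y → h y x)
  P  = ∑ (picks xs) (λ (y , ys) → ∑ ys (h y))
  J  = ∑ xs j
  -- Only the pairs containing the head `x`; pairs inside `xs` are left to the recursive call.
  crossing : H + H′ ≤ length xs * j x + J
  crossing = begin
    H + H′                          ≡⟨ ∑-+ xs ⟨
    ∑ xs (λ y → h x y + h y x)      ≤⟨ ∑-mono xs (pair x) ⟩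
    ∑ xs (λ y → j x + j y)          ≡⟨ ∑-+ xs ⟩
    ∑ xs (λ _ → j x) + J            ≡⟨ cong (_+ J) (∑-const xs (j x)) ⟩
    length xs * j x + J             ∎
  regroup : ∀ a b c d e → a + (b + c) + (d + e) ≡ a + b + (c + e) + d
  regroup = solve-∀
  collect : ∀ l a b → l * a + b + l * b + a ≡ suc l * (a + b)
  collect = solve-∀

-- The cost process

record State (n : ℕ) : Set where
  field
    free : Fin n → Bool
    cost : Fin n → ℕ
open State

gate : Bool → ℕ → ℕ
gate b k = if b then k else 0

gain : State n → Fin n × Fin n → Fin n → ℕ
gain s (a , b) v =
  if ⌊ a ≟ v ⌋ then gate (free s a) (suc (cost s b)) else
  if ⌊ b ≟ v ⌋ then gate (free s b) (suc (cost s a)) else 0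

-- The greedy rule: an edge is taken exactly when both its ends are free, so a loop at a free vertex
-- is taken and matches that vertex.
step : State n → Fin n × Fin n → State n
step s (a , b) = record
  { free = λ v → if ⌊ a ≟ v ⌋ ∨ ⌊ b ≟ v ⌋ then free s v ∧ not (free s a ∧ free s b) else free s v
  ; cost = λ v → cost s v + gain s (a , b) v
  }

initial : State n
initial = record { free = λ _ → true ; cost = λ _ → 0 }

totalCost : State n → ℕ
totalCost s = ∑ (allFin _) (cost s)

-- A loop contributes one term only; with two, exchange-loop-edge would fail.
potential : State n → Fin n × Fin n → ℕ
potential s (a , b) =
  if ⌊ a ≟ b ⌋ then gate (free s a) (suc (cost s a))
  else gate (free s a) (suc (cost s b)) + gate (free s b) (suc (cost s a))

≟-true : (a : Fin n) → ⌊ a ≟ a ⌋ ≡ true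
≟-true a = trans (isYes≗does (a ≟ a)) (dec-true (a ≟ a) refl)

≟-false : {a b : Fin n} → a ≢ b → ⌊ a ≟ b ⌋ ≡ false
≟-false {a = a} {b} a≢b = trans (isYes≗does (a ≟ b)) (dec-false (a ≟ b) a≢b)

potential-swap : (s : State n) (x : Fin n × Fin n) → potential s (swap x) ≡ potential s x
potential-swap s (a , b) with a ≟ b
... | yes refl rewrite ≟-true a = refl
... | no a≢b   rewrite ≟-false (≢-sym a≢b) = +-comm (gate (free s b) _) _

free-step-swap : (s : State n) (x : Fin n × Fin n) (v : Fin n) →
                 free (step s (swap x)) v ≡ free (step s x) v
free-step-swap s (a , b) v
  rewrite ∨-comm ⌊ b ≟ v ⌋ ⌊ a ≟ v ⌋ | ∧-comm (free s b) (free s a) = refl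

cost-step-swap : (s : State n) (x : Fin n × Fin n) (v : Fin n) →
                 cost (step s (swap x)) v ≡ cost (step s x) v
cost-step-swap s (a , b) v with a ≟ v | b ≟ v
... | yes refl | yes refl = refl
... | yes _    | no _     = refl
... | no _     | yes _    = refl
... | no _     | no _     = refl

potential-cong : {s t : State n} → (∀ v → free s v ≡ free t v) → (∀ v → cost s v ≡ cost t v) →
                 (x : Fin n × Fin n) → potential s x ≡ potential t x
potential-cong f c (a , b) rewrite f a | f b | c a | c b = refl

potential-step-swap : (s : State n) (x y : Fin n × Fin n) →
                      potential (step s (swap x)) y ≡ potential (step s x) y
potential-step-swap s x = potential-cong (free-step-swap s x) (cost-step-swap s x)

-- The exchange inequality for two edges.

ExchangeBound : State n → Fin n × Fin n → Fin n × Fin n → Set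
ExchangeBound s x y =
  potential (step s x) y + potential (step s y) x ≤ potential s x + potential s y

-- Edges are stored as ordered pairs. Reversing either one leaves the inequality unchanged, so a
-- shared vertex can be assumed to come first in both.
exchange-swapˡ : (s : State n) (x y : Fin n × Fin n) → ExchangeBound s (swap x) y → ExchangeBound s x y
exchange-swapˡ s x y = subst₂ _≤_
  (cong₂ _+_ (potential-step-swap s x y) (potential-swap (step s y) x))
  (cong (_+ potential s y) (potential-swap s x))

exchange-swapʳ : (s : State n) (x y : Fin n × Fin n) → ExchangeBound s x (swap y) → ExchangeBound s x y
exchange-swapʳ s x y = subst₂ _≤_
  (cong₂ _+_ (potential-swap (step s x) y) (potential-step-swap s y x))
  (cong (potential s x +_) (potential-swap s y))

exchange-comm : (s : State n) (x y : Fin n × Fin n) → ExchangeBound s y x → ExchangeBound s x y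
exchange-comm s x y = subst₂ _≤_
  (+-comm (potential (step s y) x) _) (+-comm (potential s y) _)

-- A free `a` is matched by the loop, which kills its term in the edge. In the other order the edge
-- either matches `a` and kills the loop, or, with `d` matched, raises the loop by the `suc D` that
-- was lost.
exchange-loop-edge : (s : State n) {a d : Fin n} → a ≢ d → ExchangeBound s (a , a) (a , d)
exchange-loop-edge s {a} {d} a≢d
  rewrite ≟-true a | ≟-false a≢d
  with free s a | free s d | cost s a | cost s d
-- The only case with slack, namely `suc D`.
... | true  | true  | A | D = ≤-trans (m≤m+n _ (suc D)) (≤-reflexive (arith A D))
  where
  arith : ∀ A D → suc (A + suc A) + 0 + suc D ≡ suc A + (suc D + suc A)
  arith = solve-∀
... | true  | false | A | D = ≤-reflexive (arith A D)
  where
  arith : ∀ A D → suc (A + suc D) ≡ suc A + (suc D + 0)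
  arith = solve-∀
... | false | true  | A | D = ≤-reflexive (arith A D)
  where
  arith : ∀ A D → suc (A + 0) + 0 ≡ 0 + (0 + suc A)
  arith = solve-∀
... | false | false | A | D = z≤n

-- If all ends are free, the first copy matches them and the second has potential zero. If just one
-- of two distinct ends is free, its term depends on the cost of the matched end, which is frozen,
-- so the potential stays the same.
exchange-parallel : (s : State n) (x : Fin n × Fin n) → ExchangeBound s x x
exchange-parallel s (a , d) with a ≟ d
... | yes refl rewrite ≟-true a with free s a | cost s a
...   | true  | A = z≤n
...   | false | A = z≤n
exchange-parallel s (a , d) | no a≢d
  rewrite ≟-true a | ≟-true d
  with free s a | free s d | cost s a | cost s d
... | true  | true  | A | D = z≤n
... | true  | false | A | D = ≤-reflexive (arith D)
  where
  arith : ∀ D → suc (D + 0) + 0 + (suc (D + 0) + 0) ≡ suc D + 0 + (suc D + 0)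
  arith = solve-∀
... | false | true  | A | D = ≤-reflexive (arith A)
  where
  arith : ∀ A → 0 + suc (A + 0) + (0 + suc (A + 0)) ≡ 0 + suc A + (0 + suc A)
  arith = solve-∀
... | false | false | A | D = z≤n

-- Equality holds throughout. For free `a`, a free `b` makes `(a , b)` remove the term `suc D` of
-- `a` in `(a , d)`, while in the other order the term of `b` grows by `suc D`; the same holds with
-- `b` and `d` interchanged. For matched `a` its cost is frozen and nothing changes.
exchange-fork : (s : State n) {a b d : Fin n} → a ≢ b → a ≢ d → b ≢ d → ExchangeBound s (a , b) (a , d)
exchange-fork s {a} {b} {d} a≢b a≢d b≢d
  rewrite ≟-true a | ≟-false a≢b | ≟-false a≢d | ≟-false b≢d | ≟-false (≢-sym b≢d)
  with free s a | free s b | free s d | cost s a | cost s b | cost s d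
... | true  | true  | true  | A | B | D = ≤-reflexive (arith A B D)
  where
  arith : ∀ A B D → suc (A + suc B) + suc (A + suc D) ≡ suc B + suc A + (suc D + suc A)
  arith = solve-∀
... | true  | true  | false | A | B | D = ≤-reflexive (arith A B D)
  where
  arith : ∀ A B D → suc (B + 0) + suc (A + suc D) ≡ suc B + suc A + (suc D + 0)
  arith = solve-∀
... | true  | false | true  | A | B | D = ≤-reflexive (arith A B D)
  where
  arith : ∀ A B D → suc (D + 0) + suc (A + suc B) + 0 ≡ suc B + 0 + (suc D + suc A)
  arith = solve-∀
... | true  | false | false | A | B | D = ≤-reflexive (arith B D)
  where
  arith : ∀ B D → suc (D + 0) + 0 + (suc (B + 0) + 0) ≡ suc B + 0 + (suc D + 0)
  arith = solve-∀
... | false | b     | d     | A | B | D rewrite +-identityʳ A = ≤-reflexive (+-comm (gate d (suc A)) _)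

exchange-shared : (s : State n) (a b d : Fin n) → ExchangeBound s (a , b) (a , d)
exchange-shared s a b d = cases (b ≟ d) (a ≟ b) (a ≟ d)
  where
  cases : Dec (b ≡ d) → Dec (a ≡ b) → Dec (a ≡ d) → ExchangeBound s (a , b) (a , d)
  cases (yes refl) _          _          = exchange-parallel s (a , b)
  cases (no _)     (yes refl) (yes refl) = exchange-parallel s (a , a)
  cases (no _)     (yes refl) (no a≢d)   = exchange-loop-edge s a≢d
  cases (no _)     (no a≢b)   (yes refl) = exchange-comm s (a , b) (a , a) (exchange-loop-edge s a≢b)
  cases (no b≢d)   (no a≢b)   (no a≢d)   = exchange-fork s a≢b a≢d b≢d

potential-step-disjoint : (s : State n) {a b c d : Fin n} → a ≢ c → a ≢ d → b ≢ c → b ≢ d →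
                          potential (step s (a , b)) (c , d) ≡ potential s (c , d)
potential-step-disjoint s {a} {b} {c} {d} a≢c a≢d b≢c b≢d
  rewrite ≟-false a≢c | ≟-false a≢d | ≟-false b≢c | ≟-false b≢d
        | +-identityʳ (cost s c) | +-identityʳ (cost s d) = refl

exchange : (s : State n) (x y : Fin n × Fin n) → ExchangeBound s x y
exchange s (a , b) (c , d) = cases (a ≟ c) (a ≟ d) (b ≟ c) (b ≟ d)
  where
  cases : Dec (a ≡ c) → Dec (a ≡ d) → Dec (b ≡ c) → Dec (b ≡ d) → ExchangeBound s (a , b) (c , d)
  cases (yes refl) _ _ _ = exchange-shared s a b d
  cases _ (yes refl) _ _ = exchange-swapʳ s (a , b) (c , a) (exchange-shared s a b c)
  cases _ _ (yes refl) _ = exchange-swapˡ s (a , b) (b , d) (exchange-shared s b a d)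
  cases _ _ _ (yes refl) =
    exchange-swapˡ s (a , b) (c , b) (exchange-swapʳ s (b , a) (c , b) (exchange-shared s b a c))
  cases (no a≢c) (no a≢d) (no b≢c) (no b≢d) = ≤-reflexive (trans
    (cong₂ _+_ (potential-step-disjoint s a≢c a≢d b≢c b≢d)
               (potential-step-disjoint s (≢-sym a≢c) (≢-sym b≢c) (≢-sym a≢d) (≢-sym b≢d)))
    (+-comm (potential s (c , d)) _))

-- Growth of the total cost in one step.

∑-indicator : (a : Fin n) (k : ℕ) {vs : List (Fin n)} → Unique vs →
              ∑ vs (λ v → if ⌊ a ≟ v ⌋ then k else 0) ≤ k
∑-indicator a k [] = z≤n
∑-indicator a k {v ∷ vs} (v∉ ∷ uvs) with a ≟ v
... | no _     = ∑-indicator a k uvs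
... | yes refl = ≤-reflexive (trans (cong (k +_) (vanishes v∉)) (+-identityʳ k))
  where
  vanishes : ∀ {ws} → All (a ≢_) ws → ∑ ws (λ w → if ⌊ a ≟ w ⌋ then k else 0) ≡ 0
  vanishes []           = refl
  vanishes (a≢w ∷ a≢ws) rewrite ≟-false a≢w = vanishes a≢ws

-- Only the ends of the edge gain. Since `gain` tests `a` before `b`, a loop is charged once, in
-- agreement with its single term in `potential`.
∑-gain≤potential : (s : State n) (x : Fin n × Fin n) → ∑ (allFin n) (gain s x) ≤ potential s x
∑-gain≤potential {n} s (a , b) with a ≟ b
... | yes refl = ≤-trans (∑-mono (allFin n) bound) (∑-indicator a _ (Unique.allFin⁺ n))
  where
  bound : ∀ v → gain s (a , a) v ≤ (if ⌊ a ≟ v ⌋ then gate (free s a) (suc (cost s a)) else 0)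
  bound v with a ≟ v
  ... | yes _ = ≤-refl
  ... | no _  = z≤n
... | no _ = begin
  ∑ (allFin n) (gain s (a , b))
    ≤⟨ ∑-mono (allFin n) bound ⟩
  ∑ (allFin n) (λ v → (if ⌊ a ≟ v ⌋ then p else 0) + (if ⌊ b ≟ v ⌋ then q else 0))
    ≡⟨ ∑-+ (allFin n) ⟩
  ∑ (allFin n) (λ v → if ⌊ a ≟ v ⌋ then p else 0) + ∑ (allFin n) (λ v → if ⌊ b ≟ v ⌋ then q else 0)
    ≤⟨ +-mono-≤ (∑-indicator a p (Unique.allFin⁺ n)) (∑-indicator b q (Unique.allFin⁺ n)) ⟩
  p + q ∎
  where
  open ≤-Reasoning
  p = gate (free s a) (suc (cost s b))
  q = gate (free s b) (suc (cost s a))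
  bound : ∀ v → gain s (a , b) v ≤ (if ⌊ a ≟ v ⌋ then p else 0) + (if ⌊ b ≟ v ⌋ then q else 0)
  bound v with a ≟ v
  ... | yes _ = m≤m+n p _
  ... | no _  = ≤-refl

totalCost-step : (s : State n) (x : Fin n × Fin n) →
                 totalCost (step s x) ≤ totalCost s + potential s x
totalCost-step {n} s x = ≤-trans (≤-reflexive (∑-+ (allFin n)))
                                 (+-monoʳ-≤ (totalCost s) (∑-gain≤potential s x))

-- Averaging over all orders.

module _ {E : Set} (ends : E → Fin n × Fin n) where

  run : State n → List E → State n
  run = foldl (λ s e → step s (ends e))

  totalPotential : State n → List E → ℕ
  totalPotential s es = ∑ es (λ e → potential s (ends e))

  -- In terms of averages: after a uniformly chosen edge arrives, the expected mean potential of the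
  -- remaining edges is at most the present mean.
  totalPotential-step : (s : State n) (es : List E) →
    ∑ (picks es) (λ (e , rest) → totalPotential (step s (ends e)) rest) + totalPotential s es
    ≤ length es * totalPotential s es
  totalPotential-step s = ∑-picks-pairs λ x y → exchange s (ends x) (ends y)

  -- The sum of total cost and total potential does not grow in expectation: the arriving edge turns
  -- at most its own potential into cost.
  ∑-orders-totalCost : (k : ℕ) (s : State n) (es : List E) → length es ≡ k →
    ∑ (orders k es) (λ o → totalCost (run s o)) ≤ k ! * (totalCost s + totalPotential s es)
  ∑-orders-totalCost zero s [] refl = ≤-reflexive (sym (+-identityʳ _))
  ∑-orders-totalCost (suc k) s es eq = begin
    ∑ (orders (suc k) es) (λ o → totalCost (run s o))
      ≡⟨ ∑-orders-suc k es ⟩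
    ∑ (picks es) (λ (e , rest) → ∑ (orders k rest) (λ o → totalCost (run (step s (ends e)) o)))
      ≤⟨ ∑-mono-∈ {xs = picks es} (λ {(e , rest)} p∈ →
           ∑-orders-totalCost k (step s (ends e)) rest
             (suc-injective (trans (sym (∈-picks⇒length p∈)) eq))) ⟩
    ∑ (picks es) (λ (e , rest) →
      k ! * (totalCost (step s (ends e)) + totalPotential (step s (ends e)) rest))
      ≡⟨ ∑-*ˡ (k !) (picks es) ⟩
    k ! * ∑ (picks es) (λ (e , rest) →
      totalCost (step s (ends e)) + totalPotential (step s (ends e)) rest)
      ≡⟨ cong (k ! *_) (∑-+ (picks es)) ⟩
    k ! * (∑ (picks es) (λ (e , _) → totalCost (step s (ends e))) + P)
      ≡⟨ cong (λ t → k ! * (t + P)) (∑-picks es) ⟩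
    k ! * (∑ es (λ e → totalCost (step s (ends e))) + P)
      ≤⟨ *-monoʳ-≤ (k !) (+-monoˡ-≤ P (∑-mono es (λ e → totalCost-step s (ends e)))) ⟩
    k ! * (∑ es (λ e → totalCost s + potential s (ends e)) + P)
      ≡⟨ cong (λ t → k ! * (t + P)) (trans (∑-+ es) (cong (_+ J) (∑-const es (totalCost s)))) ⟩
    k ! * (length es * totalCost s + J + P)
      ≡⟨ cong (k ! *_) (trans (+-assoc (length es * totalCost s) J P) (cong (length es * totalCost s +_) (+-comm J P))) ⟩
    k ! * (length es * totalCost s + (P + J))
      -- The `J` spent on the arriving edges is exactly the extra summand for which
      -- `totalPotential-step` leaves room.
      ≤⟨ *-monoʳ-≤ (k !) (+-monoʳ-≤ (length es * totalCost s) (totalPotential-step s es)) ⟩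
    k ! * (length es * totalCost s + length es * J)
      ≡⟨ cong (λ l → k ! * (l * totalCost s + l * J)) eq ⟩
    k ! * (suc k * totalCost s + suc k * J)
      ≡⟨ collect (k !) (suc k) (totalCost s) J ⟩
    suc k ! * (totalCost s + J) ∎
    where
    open ≤-Reasoning
    J = totalPotential s es
    P = ∑ (picks es) (λ (e , rest) → totalPotential (step s (ends e)) rest)
    collect : ∀ f l a b → f * (l * a + l * b) ≡ l * f * (a + b)
    collect = solve-∀

  totalPotential-initial : (es : List E) → totalPotential initial es ≤ 2 * length es
  totalPotential-initial es = ≤-trans (∑-mono es (λ e → bound (ends e)))
    (≤-reflexive (trans (∑-const es 2) (*-comm (length es) 2)))
    where
    bound : ∀ x → potential initial x ≤ 2
    bound (a , b) with a ≟ b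
    ... | yes _ = s≤s z≤n
    ... | no _  = ≤-refl

  ∑-orders-totalCost-initial : (es : List E) →
    ∑ (orders (length es) es) (λ o → totalCost (run initial o)) ≤ length es ! * (2 * length es)
  ∑-orders-totalCost-initial es = ≤-trans (∑-orders-totalCost (length es) initial es refl)
    (*-monoʳ-≤ (length es !) (+-mono-≤ zeroCost (totalPotential-initial es)))
    where
    zeroCost : totalCost {n} initial ≤ 0
    zeroCost = ≤-reflexive (trans (∑-const (allFin n) 0) (*-zeroʳ (length (allFin n))))

-- The oracles along the process

++-lub : {xs ys zs : List X} → xs ⊆ zs → ys ⊆ zs → xs ++ ys ⊆ zs
++-lub {xs = xs} xs⊆zs ys⊆zs = [ xs⊆zs , ys⊆zs ]′ ∘ ∈-++⁻ xs

-- The loop of `VO` with the matching oracle abstracted to `f`; `query` does the same for the loop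
-- of `MO`.
scan : (X → Bool × List X) → List X → Bool × List X
scan f []       = false , []
scan f (e ∷ es) with f e
... | true  , cs = true , cs
... | false , cs with scan f es
...   | b , cs′ = b , cs ++ cs′

query : (X → Bool × List X) → X → List X → Bool × List X
query f e []        = true , e ∷ []
query f e (e′ ∷ es) with f e′
... | true  , cs = false , e ∷ cs
... | false , cs with query f e es
...   | b , cs′ = b , cs ++ cs′

query-cong : {f g : X → Bool × List X} {e : X} {es : List X} →
             All (λ e′ → f e′ ≡ g e′) es → query f e es ≡ query g e es
query-cong []                              = refl
query-cong {g = g} {e} {e′ ∷ es} (eq ∷ eqs) rewrite eq with g e′
... | true  , cs = refl
... | false , cs rewrite query-cong {e = e} eqs = refl

-- Both loops stop at the first positive answer, with opposite verdicts.
query-answer : (f : X → Bool × List X) (e : X) (es : List X) →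
               proj₁ (query f e es) ≡ not (proj₁ (scan f es))
query-answer f e []        = refl
query-answer f e (e′ ∷ es) with f e′
... | true  , cs = refl
... | false , cs = query-answer f e es

query-visited : (f : X → Bool × List X) (e : X) (es : List X) →
                proj₂ (query f e es) ⊆ e ∷ proj₂ (scan f es)
query-visited f e []        = id
query-visited f e (e′ ∷ es) with f e′
... | true  , cs = id
... | false , cs = ++-lub (there ∘ ∈-++⁺ˡ)
                          (⊆-trans (query-visited f e es) (∷⁺ʳ e (xs⊆ys++xs (proj₂ (scan f es)) cs)))

-- The reason why the cost of a matched vertex freezes.
scan-++-found : (f : X → Bool × List X) (es {es′} : List X) →
                proj₁ (scan f es) ≡ true → scan f (es ++ es′) ≡ scan f es
scan-++-found f (e ∷ es) {es′} found with f e
... | true  , cs = refl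
... | false , cs rewrite scan-++-found f es {es′} found = refl

scan-++-missed : (f : X → Bool × List X) (es {es′} : List X) → proj₁ (scan f es) ≡ false →
                 scan f (es ++ es′) ≡ (proj₁ (scan f es′) , proj₂ (scan f es) ++ proj₂ (scan f es′))
scan-++-missed f []       missed = refl
scan-++-missed f (e ∷ es) {es′} missed with f e
... | true  , cs = contradiction missed λ ()
... | false , cs rewrite scan-++-missed f es {es′} missed =
  cong (_ ,_) (sym (List.++-assoc cs _ _))

scan-∨-answer : (f : X → Bool × List X) (p q : X → Bool) (es : List X) →
                proj₁ (scan f (filterᵇ (λ e → p e ∨ q e) es))
                ≡ proj₁ (scan f (filterᵇ p es)) ∨ proj₁ (scan f (filterᵇ q es))
scan-∨-answer f p q [] = refl
scan-∨-answer f p q (e ∷ es) with p e | q e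
... | false | false = scan-∨-answer f p q es
... | true  | false with f e
...   | true  , _ = refl
...   | false , _ = scan-∨-answer f p q es
scan-∨-answer f p q (e ∷ es) | false | true with f e
...   | true  , _ = sym (∨-comm _ true)
...   | false , _ = scan-∨-answer f p q es
scan-∨-answer f p q (e ∷ es) | true  | true with f e
...   | true  , _ = refl
...   | false , _ = scan-∨-answer f p q es

-- Until the merged scan stops, no edge has answered true, so each edge it queries is also reached
-- by the scan for `p` or the scan for `q`. Applied to the two ends of an edge.
scan-∨-visited : (f : X → Bool × List X) (p q : X → Bool) (es : List X) →
                 proj₂ (scan f (filterᵇ (λ e → p e ∨ q e) es))
                 ⊆ proj₂ (scan f (filterᵇ p es)) ++ proj₂ (scan f (filterᵇ q es))
scan-∨-visited f p q [] = id
scan-∨-visited f p q (e ∷ es)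
  with p e | q e | scan-∨-visited f p q es
     | proj₂ (scan f (filterᵇ p es)) in eqP | proj₂ (scan f (filterᵇ q es)) in eqQ
... | false | false | ih | P | Q rewrite eqP | eqQ = ih
... | true  | false | ih | P | Q with f e
...   | true  , cs = xs⊆xs++ys cs _
...   | false , cs rewrite eqP | eqQ = ++-lub (∈-++⁺ˡ ∘ ∈-++⁺ˡ) (⊆-trans ih (++⁺ (xs⊆ys++xs P cs) id))
scan-∨-visited f p q (e ∷ es) | false | true | ih | P | Q with f e
...   | true  , cs = xs⊆ys++xs cs _
...   | false , cs rewrite eqP | eqQ = ++-lub (∈-++⁺ʳ P ∘ ∈-++⁺ˡ) (⊆-trans ih (++⁺ʳ P (xs⊆ys++xs Q cs)))
scan-∨-visited f p q (e ∷ es) | true  | true | ih | P | Q with f e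
...   | true  , cs = xs⊆xs++ys cs _
...   | false , cs rewrite eqP | eqQ =
  ++-lub (∈-++⁺ˡ ∘ ∈-++⁺ˡ) (⊆-trans ih (++⁺ (xs⊆ys++xs P cs) (xs⊆ys++xs Q cs)))

-- The invariant linking the oracles to the process.

module _ (ends : Fin m → Fin n × Fin n) (π : Vec (Fin m) m) where

  private
    mo = MO ends π
    rk = rank ends π

  earlierNeighbours : Fin m → List (Fin m)
  earlierNeighbours e =
    takeWhileᵇ (λ e′ → rk e′ <ᵇ rk e) (filterᵇ (adjacent ends e) (byRank ends π))

  -- The local functions of MO and VO have no name outside Defs; the underscores
  -- in the types of MO-loop and VO-loop are solved to them.
  mutual
    MO-suc : ∀ k e → mo (suc k) e ≡ query (mo k) e (earlierNeighbours e)
    MO-suc k e with earlierNeighbours e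
    ... | es = MO-loop k e es

    MO-loop : ∀ k e es → _ ≡ query (mo k) e es
    MO-loop k e []        = refl
    MO-loop k e (e′ ∷ es) with mo k e′
    ... | true  , cs = refl
    ... | false , cs rewrite MO-loop k e es = refl

  mutual
    VO-scan : ∀ v → VO ends π v ≡ scan (mo m) (filterᵇ (incident ends v) (byRank ends π))
    VO-scan v with filterᵇ (incident ends v) (byRank ends π)
    ... | es = VO-loop v es

    VO-loop : ∀ v es → _ ≡ scan (mo m) es
    VO-loop v []       = refl
    VO-loop v (e ∷ es) with mo m e
    ... | true  , cs = refl
    ... | false , cs rewrite VO-loop v es = refl

  earlierNeighbours-rank : ∀ e → All (λ e′ → rk e′ < rk e) (earlierNeighbours e)
  earlierNeighbours-rank e = All.map (<ᵇ⇒< _ _) (all-takeWhile (λ e′ → T? (rk e′ <ᵇ rk e))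
    (filterᵇ (adjacent ends e) (byRank ends π)))

  -- Recursive calls go to strictly smaller ranks, so any fuel above the rank of `e` suffices.
  MO-fuel : ∀ k k′ e → rk e < k → rk e < k′ → mo k e ≡ mo k′ e
  MO-fuel (suc k) (suc k′) e r<k r<k′ = begin
    mo (suc k) e                          ≡⟨ MO-suc k e ⟩
    query (mo k) e (earlierNeighbours e)  ≡⟨ query-cong (All.map fuel (earlierNeighbours-rank e)) ⟩
    query (mo k′) e (earlierNeighbours e) ≡⟨ MO-suc k′ e ⟨
    mo (suc k′) e                         ∎
    where
    open ≡-Reasoning
    fuel : ∀ {e′} → rk e′ < rk e → mo k e′ ≡ mo k′ e′
    fuel r<r = MO-fuel k k′ _ (<-≤-trans r<r (s≤s⁻¹ r<k)) (<-≤-trans r<r (s≤s⁻¹ r<k′))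

  private
    Q : List (Fin m) → Fin n → Bool × List (Fin m)
    Q es v = scan (mo m) (filterᵇ (incident ends v) es)

  -- The invariant after the edges `es` have arrived. The list `zs` may contain repetitions, so that
  -- unions become concatenations whose lengths add up.
  Covers : List (Fin m) → State n → Fin n → Set
  Covers es s v = proj₁ (Q es v) ≡ not (free s v)
                × ∃ λ zs → length zs ≤ cost s v × proj₂ (Q es v) ⊆ zs

  MO-prefix : ∀ pre {e post} → byRank ends π ≡ pre ++ e ∷ post → All (λ e′ → rk e′ < rk e) pre →
              mo m e ≡ query (mo m) e (filterᵇ (adjacent ends e) pre)
  MO-prefix pre {e} {post} split earlier = begin
    -- One extra unit of fuel, so that unfolding the call leaves recursive calls with fuel `m`.
    mo m e                               ≡⟨ MO-fuel m (suc m) e (toℕ<n _) (m<n⇒m<1+n (toℕ<n _)) ⟩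
    mo (suc m) e                         ≡⟨ MO-suc m e ⟩
    query (mo m) e (earlierNeighbours e) ≡⟨ cong (query (mo m) e) neighbours ⟩
    query (mo m) e (filterᵇ (adjacent ends e) pre) ∎
    where
    open ≡-Reasoning
    self-adjacent : adjacent ends e e ≡ true
    self-adjacent rewrite ≟-true (proj₁ (ends e)) = refl
    cut : ∀ {es} → All (λ e′ → rk e′ < rk e) es →
          takeWhileᵇ (λ e′ → rk e′ <ᵇ rk e) (filterᵇ (adjacent ends e) (es ++ e ∷ post))
          ≡ filterᵇ (adjacent ends e) es
    -- The edge `e` is adjacent to itself but not of smaller rank, so `takeWhileᵇ` stops there and
    -- never reaches `post`.
    cut [] rewrite self-adjacent | dec-false (rk e <? rk e) (<-irrefl refl) = refl
    cut {e′ ∷ es} (r<r ∷ rs) with adjacent ends e e′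
    ... | false = cut rs
    ... | true rewrite dec-true (rk e′ <? rk e) r<r = cong (e′ ∷_) (cut rs)
    neighbours : earlierNeighbours e ≡ filterᵇ (adjacent ends e) pre
    neighbours rewrite split = cut earlier

  Covers-extend : ∀ {es s} {v w : Fin n} (e : Fin m) → Covers es s v → Covers es s w →
    proj₁ (mo m e) ≡ free s v ∧ free s w →
    proj₂ (mo m e) ⊆ e ∷ proj₂ (Q es v) ++ proj₂ (Q es w) →
    let r = scan (mo m) (filterᵇ (incident ends v) es ++ e ∷ []) in
    proj₁ r ≡ not (free s v ∧ not (free s v ∧ free s w))
    × ∃ λ zs → length zs ≤ cost s v + gate (free s v) (suc (cost s w)) × proj₂ r ⊆ zs
  Covers-extend {es} {s} {v} {w} e (found , zs , zs≤ , ⊆zs) (_ , ys , ys≤ , ⊆ys) answer visited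
    with free s v
  ... | false rewrite scan-++-found (mo m) (filterᵇ (incident ends v) es) {e ∷ []} found =
    found , zs , ≤-trans zs≤ (m≤m+n _ 0) , ⊆zs
  ... | true rewrite scan-++-missed (mo m) (filterᵇ (incident ends v) es) {e ∷ []} found =
    trans (proj₁ single) (trans answer (sym (not-involutive _))) ,
    -- What the call on `e` explores around `v` is already in `zs`; only `e` and the list `ys` of
    -- the other end are new, hence `suc (cost s w)`.
    zs ++ e ∷ ys ,
    ≤-trans (≤-reflexive (List.length-++ zs)) (+-mono-≤ zs≤ (s≤s ys≤)) ,
    ++-lub (∈-++⁺ˡ ∘ ⊆zs) (⊆-trans (proj₂ single) (⊆-trans visited
      (∈-∷⁺ʳ (∈-++⁺ʳ zs (here refl)) (++⁺ ⊆zs (there ∘ ⊆ys)))))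
    where
    single : proj₁ (scan (mo m) (e ∷ [])) ≡ proj₁ (mo m e) × proj₂ (scan (mo m) (e ∷ [])) ⊆ proj₂ (mo m e)
    single with mo m e
    ... | true  , cs = refl , id
    ... | false , cs = refl , ++-lub id (λ ())

  Covers-step : ∀ pre {e post s} → byRank ends π ≡ pre ++ e ∷ post → All (λ e′ → rk e′ < rk e) pre →
                (∀ v → Covers pre s v) → ∀ v → Covers (pre ∷ʳ e) (step s (ends e)) v
  Covers-step pre {e} {post} {s} split earlier inv v
    rewrite List.filter-++ (λ e′ → T? (incident ends v e′)) pre (e ∷ []) = cases (a ≟ v) (b ≟ v)
    where
    a = proj₁ (ends e)
    b = proj₂ (ends e)
    neighbours = filterᵇ (adjacent ends e) pre

    -- The earlier neighbours of `e` are those at `a` and those at `b`, so by the invariant the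
    -- oracle follows the greedy rule of `step`.
    answer : proj₁ (mo m e) ≡ free s a ∧ free s b
    answer = begin
      proj₁ (mo m e)                               ≡⟨ cong proj₁ (MO-prefix pre split earlier) ⟩
      proj₁ (query (mo m) e neighbours)            ≡⟨ query-answer (mo m) e neighbours ⟩
      not (proj₁ (scan (mo m) neighbours))         ≡⟨ cong not (scan-∨-answer (mo m) _ _ pre) ⟩
      not (proj₁ (Q pre a) ∨ proj₁ (Q pre b))      ≡⟨ cong₂ (λ p q → not (p ∨ q)) (proj₁ (inv a)) (proj₁ (inv b)) ⟩
      not (not (free s a) ∨ not (free s b))        ≡⟨ nor-not (free s a) (free s b) ⟩
      free s a ∧ free s b                          ∎
      where
      open ≡-Reasoning
      nor-not : ∀ x y → not (not x ∨ not y) ≡ x ∧ y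
      nor-not true  y = not-involutive y
      nor-not false y = refl

    visited : proj₂ (mo m e) ⊆ e ∷ proj₂ (Q pre a) ++ proj₂ (Q pre b)
    visited rewrite MO-prefix pre split earlier = ⊆-trans (query-visited (mo m) e neighbours)
      (∷⁺ʳ e (scan-∨-visited (mo m) (incident ends a) (incident ends b) pre))

    visited′ : proj₂ (mo m e) ⊆ e ∷ proj₂ (Q pre b) ++ proj₂ (Q pre a)
    visited′ = ⊆-trans visited (∷⁺ʳ e
      (++-lub (∈-++⁺ʳ (proj₂ (Q pre b))) ∈-++⁺ˡ))

    cases : Dec (a ≡ v) → Dec (b ≡ v) →
      let r = scan (mo m) (filterᵇ (incident ends v) pre ++ filterᵇ (incident ends v) (e ∷ [])) in
      proj₁ r ≡ not (free (step s (ends e)) v)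
      × ∃ λ zs → length zs ≤ cost (step s (ends e)) v × proj₂ r ⊆ zs
    cases (yes refl) _ rewrite ≟-true a =
      Covers-extend {pre} {s} e (inv a) (inv b) answer visited
    cases (no a≢v) (yes refl) rewrite ≟-false a≢v | ≟-true b | ∧-comm (free s a) (free s b) =
      Covers-extend {pre} {s} e (inv b) (inv a) (trans answer (∧-comm (free s a) _)) visited′
    cases (no a≢v) (no b≢v)
      rewrite ≟-false a≢v | ≟-false b≢v | List.++-identityʳ (filterᵇ (incident ends v) pre)
            | +-identityʳ (cost s v) = inv v

  Covers-run : ∀ pre post {s} → byRank ends π ≡ pre ++ post →
               AllPairs (λ e e′ → rk e < rk e′) (pre ++ post) →
               (∀ v → Covers pre s v) → ∀ v → Covers (byRank ends π) (run ends s post) v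
  Covers-run pre [] split sorted inv
    rewrite split | List.++-identityʳ pre = inv
  Covers-run pre (e ∷ post) split sorted inv =
    Covers-run (pre ∷ʳ e) post (trans split reassoc) (subst (AllPairs _) reassoc sorted)
      (Covers-step pre split (before pre sorted) inv)
    where
    reassoc = sym (List.++-assoc pre (e ∷ []) post)
    before : ∀ es → AllPairs (λ e e′ → rk e < rk e′) (es ++ e ∷ post) → All (λ e′ → rk e′ < rk e) es
    before []        _        = []
    before (e′ ∷ es) (r ∷ rs) = All.lookup r (∈-++⁺ʳ es (here refl)) ∷ before es rs

  N≤cost : AllPairs (λ e e′ → rk e < rk e′) (byRank ends π) →
           ∀ v → N ends π v ≤ cost (run ends initial (byRank ends π)) v
  N≤cost sorted v with Covers-run [] (byRank ends π) refl sorted (λ _ → refl , [] , z≤n , id) v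
  ... | _ , zs , zs≤ , ⊆zs rewrite VO-scan v = ≤-trans
    (Unique-⊆-length (deduplicate-! _≟_ visited) (⊆zs ∘ ∈-deduplicate⁻ _≟_ visited)) zs≤
    where visited = proj₂ (Q (byRank ends π) v)

-- Rankings and orders of the edges

-- Pigeonhole: if `i` were missed, punching it out of the codomain would inject the domain into a
-- smaller set.
injective⇒surjective : (f : Fin m → Fin m) → Injective _≡_ _≡_ f → ∀ i → ∃ λ j → f j ≡ i
injective⇒surjective {suc m} f inj i with any? (λ j → f j ≟ i)
... | yes hit = hit
... | no miss = contradiction (injective⇒≤ (inj ∘ punchOut-injective (missed _) (missed _))) 1+n≰n
  where
  missed : ∀ j → i ≢ f j
  missed j i≡fj = miss (j , sym i≡fj)

tabulate-injective : {f g : Fin n → X} → tabulate f ≡ tabulate g → ∀ i → f i ≡ g i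
tabulate-injective {n = suc n} eq zero    = List.∷-injectiveˡ eq
tabulate-injective {n = suc n} eq (suc i) = tabulate-injective (List.∷-injectiveʳ eq) i

applyUpTo≡tabulate : (f : ℕ → X) (n : ℕ) → applyUpTo f n ≡ tabulate {n = n} (f ∘ toℕ)
applyUpTo≡tabulate f zero    = refl
applyUpTo≡tabulate f (suc n) = cong (f 0 ∷_) (applyUpTo≡tabulate (f ∘ suc) n)

filterᵇ-singleton : (p : X → Bool) {x : X} {xs : List X} → Unique xs → x ∈ xs →
                    T (p x) → (∀ y → T (p y) → y ≡ x) → filterᵇ p xs ≡ [ x ]
filterᵇ-singleton p {x} {_ ∷ xs} (x∉ ∷ _) (here refl) px only
  rewrite List.filter-accept (T? ∘ p) {xs = xs} px =
  cong (x ∷_) (List.filter-none (T? ∘ p) (All.map (λ x≢y py → x≢y (sym (only _ py))) x∉))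
filterᵇ-singleton p {x} {y ∷ xs} (y∉ ∷ uxs) (there x∈) px only
  rewrite List.filter-reject (T? ∘ p) {x = y} {xs} (λ py → All.lookup y∉ x∈ (only y py)) =
  filterᵇ-singleton p uxs x∈ px only

-- Injectivity is asked on the entries only, since `byRank` can identify vectors that are not
-- rankings.
Unique-map-∈ : (f : X → Y) {xs : List X} → Unique xs →
               (∀ {x y} → x ∈ xs → y ∈ xs → f x ≡ f y → x ≡ y) → Unique (map f xs)
Unique-map-∈ f []           inj = []
Unique-map-∈ f {x ∷ xs} (x∉ ∷ uxs) inj =
  All.tabulate fx≢ ∷ Unique-map-∈ f uxs (λ y∈ z∈ → inj (there y∈) (there z∈))
  where
  fx≢ : ∀ {z} → z ∈ map f xs → f x ≢ z
  fx≢ z∈ fx≡z with ∈-map⁻ f z∈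
  ... | y , y∈ , refl = All.lookup x∉ y∈ (inj (here refl) (there y∈) fx≡z)

module _ (ends : Fin m → Fin n × Fin n) where

  allVecs≡ : ∀ k → allVecs ends (suc k) ≡ cartesianProductWith _∷ᵥ_ (allFin m) (allVecs ends k)
  allVecs≡ k = go (allFin m)
    where
    go : ∀ is → concatMap (λ i → map (i ∷ᵥ_) (allVecs ends k)) is
              ≡ cartesianProductWith _∷ᵥ_ is (allVecs ends k)
    go []       = refl
    go (i ∷ is) = cong (map (i ∷ᵥ_) (allVecs ends k) ++_) (go is)

  allVecs-unique : ∀ k → Unique (allVecs ends k)
  allVecs-unique zero    = [] ∷ []
  allVecs-unique (suc k) rewrite allVecs≡ k =
    Unique.cartesianProductWith⁺ _∷ᵥ_ Vec.∷-injective (Unique.allFin⁺ m) (allVecs-unique k)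

  rankings-unique : Unique (rankings ends)
  rankings-unique = Unique.filter⁺ (T? ∘ isRanking ends) (allVecs-unique m)

  isRanking⇒injective : ∀ {π} → T (isRanking ends π) → Injective _≡_ _≡_ (lookup π)
  isRanking⇒injective {π} ranking {i} {j} πi≡πj
    with All.lookup (all⁺ _ (allFin m) (All.lookup (all⁺ _ (allFin m) ranking) (∈-allFin i))) (∈-allFin j)
  ... | t with i ≟ j
  ...   | yes i≡j = i≡j
  ...   | no _ rewrite πi≡πj | ≟-true (lookup π j) = contradiction t λ ()

  module _ (π : Vec (Fin m) m) (inj : Injective _≡_ _≡_ (lookup π)) where

    edgeAt : Fin m → Fin m
    edgeAt i = proj₁ (injective⇒surjective (lookup π) inj i)

    lookup-edgeAt : ∀ i → lookup π (edgeAt i) ≡ i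
    lookup-edgeAt i = proj₂ (injective⇒surjective (lookup π) inj i)

    edgeAt-lookup : ∀ e → edgeAt (lookup π e) ≡ e
    edgeAt-lookup e = inj (lookup-edgeAt (lookup π e))

    -- Each rank is held by exactly one edge, so every bucket of `byRank` is a singleton.
    byRank≡ : byRank ends π ≡ tabulate edgeAt
    byRank≡ = begin
      concatMap ofRank (upTo m)                 ≡⟨ cong concat (List.map-upTo ofRank m) ⟩
      concat (applyUpTo ofRank m)               ≡⟨ cong concat (applyUpTo≡tabulate ofRank m) ⟩
      concat (tabulate {n = m} (ofRank ∘ toℕ))  ≡⟨ cong concat (List.tabulate-cong ofRank≡) ⟩
      concat (tabulate (λ i → [ edgeAt i ]))    ≡⟨ cong concat (List.map-tabulate edgeAt [_]) ⟨
      concat (map [_] (tabulate edgeAt))        ≡⟨ List.concat-map-[_] (tabulate edgeAt) ⟩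
      tabulate edgeAt                           ∎
      where
      open ≡-Reasoning
      ofRank : ℕ → List (Fin m)
      ofRank r = filterᵇ (λ e → rank ends π e ≡ᵇ r) (allFin m)
      ofRank≡ : ∀ i → ofRank (toℕ i) ≡ [ edgeAt i ]
      ofRank≡ i = filterᵇ-singleton _ (Unique.allFin⁺ m) (∈-allFin (edgeAt i))
        (≡⇒≡ᵇ _ _ (cong toℕ (lookup-edgeAt i)))
        (λ e r → trans (sym (edgeAt-lookup e)) (cong edgeAt (toℕ-injective (≡ᵇ⇒≡ _ _ r))))

    byRank-sorted : AllPairs (λ e e′ → rank ends π e < rank ends π e′) (byRank ends π)
    byRank-sorted rewrite byRank≡ = AllPairs.tabulate⁺-< λ {i} {j} i<j →
      subst₂ (λ a b → toℕ a < toℕ b) (sym (lookup-edgeAt i)) (sym (lookup-edgeAt j)) i<j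

    byRank∈orders : byRank ends π ∈ orders m (allFin m)
    byRank∈orders rewrite byRank≡ =
      subst (λ k → tabulate edgeAt ∈ orders k (allFin m)) (List.length-tabulate edgeAt)
        (Unique-⊆-orders (Unique.tabulate⁺ edgeAt-injective) (λ _ → ∈-allFin _))
      where
      edgeAt-injective : ∀ {i j} → edgeAt i ≡ edgeAt j → i ≡ j
      edgeAt-injective {i} {j} eq = trans (sym (lookup-edgeAt i)) (trans (cong (lookup π) eq) (lookup-edgeAt j))

  -- The sorted list determines the inverse permutation `edgeAt`, and hence the ranking.
  byRank-injective : ∀ {π π′} → Injective _≡_ _≡_ (lookup π) → Injective _≡_ _≡_ (lookup π′) →
                     byRank ends π ≡ byRank ends π′ → π ≡ π′
  byRank-injective {π} {π′} inj inj′ eq = begin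
    π                       ≡⟨ Vec.tabulate∘lookup π ⟨
    Vec.tabulate (lookup π) ≡⟨ Vec.tabulate-cong same ⟩
    Vec.tabulate (lookup π′) ≡⟨ Vec.tabulate∘lookup π′ ⟩
    π′                      ∎
    where
    open ≡-Reasoning
    edgeAt≗ : ∀ i → edgeAt π inj i ≡ edgeAt π′ inj′ i
    edgeAt≗ = tabulate-injective (trans (sym (byRank≡ π inj)) (trans eq (byRank≡ π′ inj′)))
    same : ∀ e → lookup π e ≡ lookup π′ e
    same e = begin
      lookup π e                             ≡⟨ lookup-edgeAt π′ inj′ (lookup π e) ⟨
      lookup π′ (edgeAt π′ inj′ (lookup π e))   ≡⟨ cong (lookup π′) (edgeAt≗ (lookup π e)) ⟨
      lookup π′ (edgeAt π inj (lookup π e))    ≡⟨ cong (lookup π′) (edgeAt-lookup π inj e) ⟩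
      lookup π′ e                            ∎

  ∈-rankings⇒injective : ∀ {π} → π ∈ rankings ends → Injective _≡_ _≡_ (lookup π)
  ∈-rankings⇒injective {π} π∈ =
    isRanking⇒injective {π} (proj₂ (∈-filter⁻ (T? ∘ isRanking ends) {xs = allVecs ends m} π∈))

  totalN≤ : totalN ends ≤ m ! * (2 * m)
  totalN≤ = begin
    totalN ends
      ≤⟨ ∑-mono-∈ (λ {π} π∈ → ∑-mono (allFin n) (N≤cost ends π (byRank-sorted π (∈-rankings⇒injective π∈)))) ⟩
    ∑ (rankings ends) (finalCost ∘ byRank ends)
      ≡⟨ ∑-map (byRank ends) (rankings ends) ⟨
    ∑ (map (byRank ends) (rankings ends)) finalCost
      -- Sorting injects the rankings into the orders of the edges, and further orders could only
      -- increase the sum.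
      ≤⟨ Unique-⊆-∑ orders-unique orders-⊆ ⟩
    ∑ (orders m (allFin m)) finalCost
      ≤⟨ subst (λ k → ∑ (orders k (allFin m)) finalCost ≤ k ! * (2 * k)) (List.length-tabulate {A = Fin m} {n = m} id)
           (∑-orders-totalCost-initial ends (allFin m)) ⟩
    m ! * (2 * m) ∎
    where
    open ≤-Reasoning
    finalCost : List (Fin m) → ℕ
    finalCost o = totalCost (run ends initial o)
    orders-unique : Unique (map (byRank ends) (rankings ends))
    orders-unique = Unique-map-∈ (byRank ends) rankings-unique
      (λ π∈ π′∈ → byRank-injective (∈-rankings⇒injective π∈) (∈-rankings⇒injective π′∈))
    orders-⊆ : map (byRank ends) (rankings ends) ⊆ orders m (allFin m)
    orders-⊆ o∈ with ∈-map⁻ (byRank ends) o∈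
    ... | π , π∈ , refl = byRank∈orders π (∈-rankings⇒injective π∈)

  -- The fold for the minimum is seeded with `maxDegree`, and each further entry can only lower it.
  minDegree≤maxDegree : minDegree ends ≤ maxDegree ends
  minDegree≤maxDegree = bounded (map (degree ends) (allFin n))
    where
    bounded : ∀ ds → foldr _⊓_ (maxDegree ends) ds ≤ maxDegree ends
    bounded []       = ≤-refl
    bounded (d ∷ ds) = ≤-trans (m⊓n≤n d _) (bounded ds)

-- The bound with denominators cleared: the average degree is `2 * m` over `n`, the ratio is
-- `maxDegree` over `minDegree`, and both sides are multiplied by `n`, `m !` and `minDegree`.
theorem1 : Σ ℕ (λ C → (n m : ℕ) (ends : Fin m → Fin n × Fin n) → 0 < n → ((v : Fin n) → 1 ≤ degree ends v) → minDegree ends * totalN ends ≤ C * maxDegree ends * (2 * m) * (m !))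
theorem1 = 1 , λ n m ends _ _ → ≤-trans
  (*-mono-≤ (minDegree≤maxDegree ends) (totalN≤ ends))
  (≤-reflexive (reorder (maxDegree ends) m (m !)))
  where
  reorder : ∀ Δ m f → Δ * (f * (2 * m)) ≡ 1 * Δ * (2 * m) * f
  reorder = solve-∀
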